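{- For every graph $G$, as $t\to\infty$, $\pi_t^*(G)\in \hat{\pi}^*(G)\,t+\Theta(1)$; that is, $\pi_t^*(G)-\hat{\pi}^*(G)\,t$ is bounded by a constant independent of $t$.
   Context: Graphs are finite simple graphs. A distribution on a graph $G=(V,E)$ is a function $D:V\to\mathbb{N}$, with size $|D|=\sum_v D(v)$. A pebbling move removes two pebbles from a vertex having at least two pebbles and places one pebble on a neighbor. A distribution $D$ is $t$-solvable if for every vertex $v$, some sequence of pebbling moves starting from $D$ results in a distribution with at least $t$ pebbles on $v$. The optimal $t$-pebbling number $\pi_t^*(G)$ is the minimum size of a $t$-solvable distribution on $G$. The optimal fractional pebbling number is $\hat{\pi}^*(G)=\liminf_{t\to\infty}\pi_t^*(G)/t$. -}

module Defs where

open import Data.Nat as ℕ using (ℕ; zero; suc; _∸_)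
open import Data.Bool using (Bool; true; false; T)
open import Data.Fin using (Fin; _≟_)
open import Data.List using (map; allFin)
open import Data.Nat.ListAction using (sum)
open import Data.Product using (Σ; ∃; _×_; _,_)
open import Data.Integer using (+_)
open import Data.Rational as ℚ using (ℚ; 0ℚ; _/_; _-_; ∣_∣)
open import Relation.Nullary using (¬_; yes; no)
open import Relation.Binary.PropositionalEquality using (_≡_)
open import Relation.Binary.Construct.Closure.ReflexiveTransitive using (Star)

record Graph : Set where
  field
    n     : ℕ
    adj   : Fin n → Fin n → Bool
    sym   : ∀ u v → adj u v ≡ adj v u
    irrefl : ∀ v → adj v v ≡ false
open Graph public

Distribution : Graph → Set
Distribution G = Fin (n G) → ℕ

size : (G : Graph) → Distribution G → ℕ
size G D = sum (map D (allFin (n G)))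

-- Result of moving: remove two pebbles from u, add one on v (u ≠ v as adjacent).
move : (G : Graph) → Distribution G → Fin (n G) → Fin (n G) → Distribution G
move G D u v w with w ≟ u | w ≟ v
... | yes _ | _     = D w ∸ 2
... | no _  | yes _ = suc (D w)
... | no _  | no _  = D w

data Step (G : Graph) (D : Distribution G) : Distribution G → Set where
  step : (u v : Fin (n G)) → T (adj G u v) → 2 ℕ.≤ D u → Step G D (move G D u v)

Reachable : (G : Graph) → Distribution G → Distribution G → Set
Reachable G = Star (Step G)

Solvable : (G : Graph) → ℕ → Distribution G → Set
Solvable G t D = ∀ (r : Fin (n G)) → ∃ λ D' → Reachable G D D' × t ℕ.≤ D' r

IsOptPebNum : (G : Graph) → ℕ → ℕ → Set
IsOptPebNum G t m =
  (∃ λ D → Solvable G t D × size G D ≡ m) × (∀ D → Solvable G t D → m ℕ.≤ size G D)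

ℕ→ℚ : ℕ → ℚ
ℕ→ℚ m = + m / 1

-- q is liminf_{t→∞} π_t^*(G)/t  (ratios compared as  x ≤ m/t  ⇔  x·t ≤ m, t ≥ 1).
IsOptFracPebNum : Graph → ℚ → Set
IsOptFracPebNum G q =
  (∀ (ε : ℚ) → 0ℚ ℚ.< ε → ∃ λ T → ∀ t m → T ℕ.≤ t → 1 ℕ.≤ t → IsOptPebNum G t m →
      (q - ε) ℚ.* ℕ→ℚ t ℚ.≤ ℕ→ℚ m)
  × (∀ (ε : ℚ) → 0ℚ ℚ.< ε → ∀ T → ∃ λ t → ∃ λ m → T ℕ.≤ t × 1 ℕ.≤ t × IsOptPebNum G t m ×
      ℕ→ℚ m ℚ.≤ (q ℚ.+ ε) ℚ.* ℕ→ℚ t)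

{-# OPTIONS --safe #-}

-- Fix a root r and let W be a large power of 2.  The weights a(v) = W 2^{-dist(v,r)} do not increase
-- in total under a pebbling move, so a t-solvable D satisfies Σ a(v) D(v) ≥ W t; conversely W pebbles
-- on v can be turned into a(v) pebbles on r.  Hence solvability is a covering program up to
-- divisibility: the rational program "minimise Σ x subject to A x ≥ W" attains its optimum q (by
-- Fourier–Motzkin elimination), every t-solvable D has size at least q t, and clearing denominators
-- in an optimal x gives a Q such that size q t is attained at every multiple t of Q.  Rounding t up
-- to a multiple of Q yields q t ≤ π_t^* ≤ q t + q Q.
module Submission where

open import Defs hiding (sym)
open import Algebra.Bundles using (CommutativeRing)
open import Data.Bool using (T)
open import Data.Bool.Properties using (T?)
open import Data.Fin using (Fin; zero; suc; _≟_)
open import Data.Fin.Properties using (any?)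
import Data.Integer as ℤ
import Data.Integer.Properties as ℤ
open import Data.List using (List; []; _∷_; _++_; map; tabulate; cartesianProductWith)
import Data.List.Extrema
open import Data.List.Membership.Propositional using (_∈_)
open import Data.List.Membership.Propositional.Properties using (∈-cartesianProductWith⁺)
open import Data.List.Properties using (map-tabulate)
open import Data.List.Relation.Unary.All as All using (All; []; _∷_)
open import Data.List.Relation.Unary.All.Properties
  using (++⁺; ++⁻ˡ; ++⁻ʳ; cartesianProductWith⁺; map⁺; map⁻; tabulate⁺; tabulate⁻)
open import Data.Nat as ℕ using (ℕ; zero; suc; s≤s; z≤n)
open import Data.Nat.DivMod using (_/_; m≡m%n+[m/n]*n; m%n≤n; m/n*n≤m)
open import Data.Nat.Divisibility using (_∣_; divides; m∣m*n; ∣n⇒∣m*n)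
open import Data.Nat.ListAction using (sum)
import Data.Nat.Properties as ℕ
open import Data.Nat.Solver using () renaming (module +-*-Solver to ℕS)
open import Data.Product using (∃; _×_; _,_; proj₁; proj₂)
open import Data.Rational hiding (_≟_; _/_)
open import Data.Rational.Properties hiding (_≟_)
open import Data.Rational.Solver using (module +-*-Solver)
open import Data.Rational.Unnormalised as ℚᵘ using (ℚᵘ; mkℚᵘ; *≡*; *≤*)
import Data.Rational.Unnormalised.Properties as ℚᵘ
open import Data.Vec.Functional using (Vector) renaming (_∷_ to _◂_)
open import Function using (_∘_; _⇔_; mk⇔; Equivalence)
open import Relation.Binary.Bundles using (DecTotalOrder)
open import Relation.Binary.Construct.Closure.ReflexiveTransitive using (ε; _◅_; _◅◅_)
open import Relation.Binary.Definitions using (tri<; tri≈; tri>)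
open import Relation.Binary.PropositionalEquality
  using (_≡_; refl; sym; trans; cong; cong₂; subst; setoid; module ≡-Reasoning)
open import Relation.Nullary using (¬_; Dec; yes; no; contradiction)
open import Relation.Nullary.Decidable using (_×-dec_)

open Equivalence
open +-*-Solver using (solve; _:=_; _:+_; _:*_; _:-_; :-_)
open Data.List.Extrema (DecTotalOrder.totalOrder ≤-decTotalOrder)
  using (max; min; min≤xs; xs≤max; ⊥≤max; max≤v⁺)

module Σℕ where
  open import Algebra.Properties.Semiring.Sum ℕ.+-*-semiring public
module Σℚ where
  open import Algebra.Properties.Semiring.Sum (CommutativeRing.semiring +-*-commutativeRing) public

private variable
  d : ℕ

-- Sums of natural numbers

sum-mono-≤ : ∀ {f g : Vector ℕ d} → (∀ i → f i ℕ.≤ g i) → Σℕ.sum f ℕ.≤ Σℕ.sum g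
sum-mono-≤ {zero}  f≤g = z≤n
sum-mono-≤ {suc _} f≤g = ℕ.+-mono-≤ (f≤g zero) (sum-mono-≤ (f≤g ∘ suc))

sum-mono-< : ∀ {f g : Vector ℕ d} → (∀ i → f i ℕ.≤ g i) → ∀ j → f j ℕ.< g j →
  Σℕ.sum f ℕ.< Σℕ.sum g
sum-mono-< f≤g zero    fj<gj = ℕ.+-mono-<-≤ fj<gj (sum-mono-≤ (f≤g ∘ suc))
sum-mono-< f≤g (suc j) fj<gj = ℕ.+-mono-≤-< (f≤g zero) (sum-mono-< (f≤g ∘ suc) j fj<gj)

term≤sum : ∀ (f : Vector ℕ d) i → f i ℕ.≤ Σℕ.sum f
term≤sum f zero    = ℕ.m≤m+n (f zero) _
term≤sum f (suc i) = ℕ.≤-trans (term≤sum (f ∘ suc) i) (ℕ.m≤n+m _ (f zero))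

-- Plays two roles: the unit vector of the linear program and the distribution with a single pebble.
δ : Fin d → Fin d → ℕ
δ zero    zero    = 1
δ zero    (suc _) = 0
δ (suc _) zero    = 0
δ (suc i) (suc j) = δ i j

δ-refl : ∀ (i : Fin d) → δ i i ≡ 1
δ-refl zero    = refl
δ-refl (suc i) = δ-refl i

δ-≢ : ∀ {i j : Fin d} → ¬ i ≡ j → δ i j ≡ 0
δ-≢ {i = zero}  {zero}  i≢j = contradiction refl i≢j
δ-≢ {i = zero}  {suc _} i≢j = refl
δ-≢ {i = suc _} {zero}  i≢j = refl
δ-≢ {i = suc _} {suc _} i≢j = δ-≢ (i≢j ∘ cong suc)

δ-sym : ∀ (i j : Fin d) → δ i j ≡ δ j i
δ-sym zero    zero    = refl
δ-sym zero    (suc _) = refl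
δ-sym (suc _) zero    = refl
δ-sym (suc i) (suc j) = δ-sym i j

sum-δ : ∀ (f : Vector ℕ d) j → (Σℕ.sum λ i → f i ℕ.* δ i j) ≡ f j
sum-δ {suc k} f zero = trans
  (cong₂ ℕ._+_ (ℕ.*-identityʳ (f zero))
    (trans (Σℕ.sum-cong-≗ λ i → ℕ.*-zeroʳ (f (suc i))) (Σℕ.sum-replicate-zero k)))
  (ℕ.+-identityʳ (f zero))
sum-δ f (suc j) = cong₂ ℕ._+_ (ℕ.*-zeroʳ (f zero)) (sum-δ (f ∘ suc) j)

-- Fourier–Motzkin elimination

p≤q⇒0≤q-p : ∀ {p q} → p ≤ q → 0ℚ ≤ q - p
p≤q⇒0≤q-p {p} {q} p≤q = subst (_≤ q - p) (+-inverseʳ p) (+-monoˡ-≤ (- p) p≤q)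

0≤q-p⇒p≤q : ∀ {p q} → 0ℚ ≤ q - p → p ≤ q
0≤q-p⇒p≤q {p} {q} h = begin
  p            ≡⟨ sym (+-identityˡ p) ⟩
  0ℚ + p       ≤⟨ +-monoˡ-≤ p h ⟩
  q - p + p    ≡⟨ solve 2 (λ a b → a :- b :+ b := a) refl q p ⟩
  q            ∎
  where open ≤-Reasoning

infix 7 _∙_
_∙_ : Vector ℚ d → Vector ℚ d → ℚ
c ∙ x = Σℚ.sum λ i → c i * x i

-- The row (c , β , α) stands for the affine form c ∙ x + β s + α.
Row : ℕ → Set
Row d = Vector ℚ d × ℚ × ℚ

⟦_⟧ : Row d → Vector ℚ d → ℚ → ℚ
⟦ c , β , α ⟧ x s = c ∙ x + (β * s + α)

Sat : List (Row d) → Vector ℚ d → ℚ → Set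
Sat L x s = All (λ R → 0ℚ ≤ ⟦ R ⟧ x s) L

scale : ℚ → Row d → Row d
scale k (c , β , α) = (λ i → k * c i) , k * β , k * α

_⊖_ : Row d → Row d → Row d
(c , β , α) ⊖ (c′ , β′ , α′) = (λ i → c i - c′ i) , β - β′ , α - α′

scale-∙ : ∀ k (c x : Vector ℚ d) → (λ i → k * c i) ∙ x ≡ k * (c ∙ x)
scale-∙ k c x = trans (Σℚ.sum-cong-≗ λ i → *-assoc k (c i) (x i)) (sym (Σℚ.*-distribˡ-sum k λ i → c i * x i))

minus-∙ : ∀ (c c′ x : Vector ℚ d) → (λ i → c i - c′ i) ∙ x ≡ c ∙ x - c′ ∙ x
minus-∙ {zero}  c c′ x = refl
minus-∙ {suc _} c c′ x = trans
  (cong ((c zero - c′ zero) * x zero +_) (minus-∙ (c ∘ suc) (c′ ∘ suc) (x ∘ suc)))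
  (solve 5 (λ a b y p q → (a :- b) :* y :+ (p :- q) := (a :* y :+ p) :- (b :* y :+ q)) refl
    (c zero) (c′ zero) (x zero) ((c ∘ suc) ∙ (x ∘ suc)) ((c′ ∘ suc) ∙ (x ∘ suc)))

⟦scale⟧ : ∀ k (R : Row d) x s → ⟦ scale k R ⟧ x s ≡ k * ⟦ R ⟧ x s
⟦scale⟧ k (c , β , α) x s = trans (cong (_+ (k * β * s + k * α)) (scale-∙ k c x))
  (solve 5 (λ k p b s a → k :* p :+ (k :* b :* s :+ k :* a) := k :* (p :+ (b :* s :+ a))) refl
    k (c ∙ x) β s α)

⟦⊖⟧ : ∀ (R S : Row d) x s → ⟦ R ⊖ S ⟧ x s ≡ ⟦ R ⟧ x s - ⟦ S ⟧ x s
⟦⊖⟧ (c , β , α) (c′ , β′ , α′) x s = trans (cong (_+ ((β - β′) * s + (α - α′))) (minus-∙ c c′ x))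
  (solve 7 (λ p p′ b b′ s a a′ →
      (p :- p′) :+ ((b :- b′) :* s :+ (a :- a′)) := (p :+ (b :* s :+ a)) :- (p′ :+ (b′ :* s :+ a′))) refl
    (c ∙ x) (c′ ∙ x) β β′ s α α′)

dropHead : Row (suc d) → Row d
dropHead (c , β , α) = c ∘ suc , β , α

⟦dropHead⟧ : ∀ (R : Row (suc d)) x s →
  ⟦ R ⟧ x s ≡ proj₁ R zero * x zero + ⟦ dropHead R ⟧ (x ∘ suc) s
⟦dropHead⟧ (c , β , α) x s = +-assoc (c zero * x zero) ((c ∘ suc) ∙ (x ∘ suc)) (β * s + α)

module _ (R : Row (suc d)) .{{_ : NonZero (proj₁ R zero)}} where

  private a = proj₁ R zero

  -- The root of `R` in its first variable: the value of `x zero` at which the row vanishes, as an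
  -- affine form in the remaining variables.
  headBound : Row d
  headBound = scale (- (1/ a)) (dropHead R)

  ⟦headBound⟧ : ∀ x s → ⟦ R ⟧ x s ≡ a * (x zero - ⟦ headBound ⟧ (x ∘ suc) s)
  ⟦headBound⟧ x s = begin
    ⟦ R ⟧ x s                              ≡⟨ ⟦dropHead⟧ R x s ⟩
    a * x zero + g                         ≡⟨ cong (a * x zero +_) (sym (*-identityˡ g)) ⟩
    a * x zero + 1ℚ * g                    ≡⟨ cong (λ e → a * x zero + e * g) (sym (*-inverseʳ a)) ⟩
    a * x zero + a * (1/ a) * g            ≡⟨ factor a (x zero) (1/ a) g ⟩
    a * (x zero - - (1/ a) * g)            ≡⟨ cong (λ e → a * (x zero - e))
                                                (sym (⟦scale⟧ (- (1/ a)) (dropHead R) (x ∘ suc) s)) ⟩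
    a * (x zero - ⟦ headBound ⟧ (x ∘ suc) s) ∎
    where
    open ≡-Reasoning
    g = ⟦ dropHead R ⟧ (x ∘ suc) s
    factor = solve 4 (λ a y i g → a :* y :+ a :* i :* g := a :* (y :- (:- i) :* g)) refl

0≤p*q⇔0≤q : ∀ p .{{_ : Positive p}} q → (0ℚ ≤ p * q) ⇔ (0ℚ ≤ q)
0≤p*q⇔0≤q p q = mk⇔
  (λ h → *-cancelˡ-≤-pos p (subst (_≤ p * q) (sym (*-zeroʳ p)) h))
  (λ h → subst (_≤ p * q) (*-zeroʳ p) (*-monoˡ-≤-nonNeg p {{pos⇒nonNeg p}} h))

0≤p*q⇔q≤0 : ∀ p .{{_ : Negative p}} q → (0ℚ ≤ p * q) ⇔ (q ≤ 0ℚ)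
0≤p*q⇔q≤0 p q = mk⇔
  (λ h → *-cancelˡ-≤-neg p (subst (_≤ p * q) (sym (*-zeroʳ p)) h))
  (λ h → subst (_≤ p * q) (*-zeroʳ p) (*-monoˡ-≤-nonPos p {{neg⇒nonPos p}} h))

record HeadBounds (L : List (Row (suc d))) : Set where
  field
    free lower upper : List (Row d)
    sat⇔ : ∀ x s → Sat L x s ⇔
      (Sat free (x ∘ suc) s
        × All (λ R → ⟦ R ⟧ (x ∘ suc) s ≤ x zero) lower
        × All (λ R → x zero ≤ ⟦ R ⟧ (x ∘ suc) s) upper)

-- Dividing a row by its head coefficient keeps or reverses the inequality according to the sign.
-- Positive coefficients therefore bound `x zero` from below, negative ones from above, and rows
-- with coefficient 0 do not constrain it.
headBounds : (L : List (Row (suc d))) → HeadBounds L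
headBounds [] = record
  { free = [] ; lower = [] ; upper = []
  ; sat⇔ = λ x s → mk⇔ (λ _ → [] , [] , []) (λ _ → []) }
headBounds (R ∷ L) with headBounds L | <-cmp (proj₁ R zero) 0ℚ
... | B | tri≈ _ a≡0 _ = record
  { free = dropHead R ∷ free ; lower = lower ; upper = upper
  ; sat⇔ = λ x s → mk⇔
      (λ { (h ∷ hs) → let f , l , u = to (sat⇔ x s) hs in
           subst (0ℚ ≤_) (value x s) h ∷ f , l , u })
      (λ { (h ∷ f , l , u) → subst (0ℚ ≤_) (sym (value x s)) h ∷ from (sat⇔ x s) (f , l , u) }) }
  where
  open HeadBounds B
  value : ∀ x s → ⟦ R ⟧ x s ≡ ⟦ dropHead R ⟧ (x ∘ suc) s
  value x s = trans (⟦dropHead⟧ R x s)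
    (trans (cong (λ e → e * x zero + g) a≡0)
      (trans (cong (_+ g) (*-zeroˡ (x zero))) (+-identityˡ g)))
    where g = ⟦ dropHead R ⟧ (x ∘ suc) s
... | B | tri> _ _ a>0 = record
  { free = free ; lower = headBound R ∷ lower ; upper = upper
  ; sat⇔ = λ x s → mk⇔
      (λ { (h ∷ hs) → let f , l , u = to (sat⇔ x s) hs in
           f , 0≤q-p⇒p≤q (to (0≤p*q⇔0≤q a _) (subst (0ℚ ≤_) (⟦headBound⟧ R x s) h)) ∷ l , u })
      (λ { (f , h ∷ l , u) →
           subst (0ℚ ≤_) (sym (⟦headBound⟧ R x s)) (from (0≤p*q⇔0≤q a _) (p≤q⇒0≤q-p h))
           ∷ from (sat⇔ x s) (f , l , u) }) }
  where
  open HeadBounds B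
  a = proj₁ R zero
  instance
    a-pos : Positive a
    a-pos = positive a>0
    a-nonZero : NonZero a
    a-nonZero = pos⇒nonZero a
... | B | tri< a<0 _ _ = record
  { free = free ; lower = lower ; upper = headBound R ∷ upper
  ; sat⇔ = λ x s → mk⇔
      (λ { (h ∷ hs) → let f , l , u = to (sat⇔ x s) hs in
           f , l , p-q≤0⇒p≤q (to (0≤p*q⇔q≤0 a _) (subst (0ℚ ≤_) (⟦headBound⟧ R x s) h)) ∷ u })
      (λ { (f , l , h ∷ u) →
           subst (0ℚ ≤_) (sym (⟦headBound⟧ R x s)) (from (0≤p*q⇔q≤0 a _) (p≤q⇒p-q≤0 h))
           ∷ from (sat⇔ x s) (f , l , u) }) }
  where
  open HeadBounds B
  a = proj₁ R zero
  instance
    a-neg : Negative a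
    a-neg = negative a<0
    a-nonZero : NonZero a
    a-nonZero = neg⇒nonZero a
  p-q≤0⇒p≤q : ∀ {p q} → p - q ≤ 0ℚ → p ≤ q
  p-q≤0⇒p≤q {p} {q} h = begin
    p          ≡⟨ solve 2 (λ p q → p := p :- q :+ q) refl p q ⟩
    p - q + q  ≤⟨ +-monoˡ-≤ q h ⟩
    0ℚ + q     ≡⟨ +-identityˡ q ⟩
    q          ∎
    where open ≤-Reasoning
  p≤q⇒p-q≤0 : ∀ {p q} → p ≤ q → p - q ≤ 0ℚ
  p≤q⇒p-q≤0 {p} {q} h = subst (p - q ≤_) (+-inverseʳ q) (+-monoˡ-≤ (- q) h)


between : ∀ {A : Set} (f : A → ℚ) (ls us : List A) →
  (∀ {l u} → l ∈ ls → u ∈ us → f l ≤ f u) →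
  ∃ λ x → All (λ l → f l ≤ x) ls × All (λ u → x ≤ f u) us
-- `m` lies below every `f u`, and raising it to the largest `f l` keeps it there by `h`. The 0
-- gives `min` a value on an empty list and otherwise can only lower `m`.
between f ls us h = max m (map f ls) , map⁻ (xs≤max m (map f ls)) ,
  All.zipWith (λ (m≤u , ls≤u) → max≤v⁺ m≤u ls≤u)
    ( map⁻ (min≤xs 0ℚ (map f us))
    , All.tabulate (λ u∈ → map⁺ (All.tabulate λ l∈ → h l∈ u∈)))
  where m = min 0ℚ (map f us)

sat-⊖⇔ : ∀ (Us Ls : List (Row d)) x s → Sat (cartesianProductWith _⊖_ Us Ls) x s ⇔
  (∀ {V U} → V ∈ Ls → U ∈ Us → ⟦ V ⟧ x s ≤ ⟦ U ⟧ x s)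
sat-⊖⇔ {d} Us Ls x s = mk⇔
  (λ h {V} {U} V∈ U∈ → 0≤q-p⇒p≤q
    (subst (0ℚ ≤_) (⟦⊖⟧ U V x s) (All.lookup h (∈-cartesianProductWith⁺ _⊖_ U∈ V∈))))
  (λ h → cartesianProductWith⁺ (setoid (Row d)) (setoid (Row d)) _⊖_ Us Ls λ {U} {V} U∈ V∈ →
    subst (0ℚ ≤_) (sym (⟦⊖⟧ U V x s)) (p≤q⇒0≤q-p (h V∈ U∈)))

-- A value for the first variable exists exactly when every lower bound is at most every upper
-- bound, so these pairwise differences replace the rows that mention it.
eliminateHead : (L : List (Row (suc d))) → ∃ λ (L′ : List (Row d)) →
  (∀ x s → Sat L x s → Sat L′ (x ∘ suc) s) × (∀ x s → Sat L′ x s → ∃ λ x₀ → Sat L (x₀ ◂ x) s)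
eliminateHead L = L′ , fwd , bwd
  where
  open HeadBounds (headBounds L)
  L′ = free ++ cartesianProductWith _⊖_ upper lower
  fwd : ∀ x s → Sat L x s → Sat L′ (x ∘ suc) s
  fwd x s h = let f , l , u = to (sat⇔ x s) h in ++⁺ f
    (from (sat-⊖⇔ upper lower (x ∘ suc) s) λ V∈ U∈ → ≤-trans (All.lookup l V∈) (All.lookup u U∈))
  bwd : ∀ x s → Sat L′ x s → ∃ λ x₀ → Sat L (x₀ ◂ x) s
  bwd x s h =
    let x₀ , l , u = between (λ R → ⟦ R ⟧ x s) lower upper
                       (to (sat-⊖⇔ upper lower x s) (++⁻ʳ free h))
    in x₀ , from (sat⇔ (x₀ ◂ x) s) (++⁻ˡ free h , l , u)

-- The parameter `s` is carried along untouched, so feasibility for a given `s` reduces to finitely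
-- many affine inequalities in `s` alone.
eliminate : (L : List (Row d)) →
  ∃ λ (L′ : List (Row 0)) → ∀ s → (∃ λ x → Sat L x s) ⇔ Sat L′ (λ ()) s
eliminate {zero} L = L , λ s → mk⇔ proj₂ (λ h → (λ ()) , h)
eliminate {suc d} L =
  let L₁ , fwd , bwd = eliminateHead L ; L₂ , sat⇔ = eliminate L₁ in
  L₂ , λ s → mk⇔
    (λ (x , h) → to (sat⇔ s) (x ∘ suc , fwd x s h))
    (λ h → let x , h₁ = from (sat⇔ s) h ; x₀ , h₀ = bwd x s h₁ in x₀ ◂ x , h₀)

-- With all x eliminated only s is left; moving it into the vector lets headBounds solve for it.
paramAsHead : Row 0 → Row 1
paramAsHead (_ , β , α) = (λ _ → β) , 0ℚ , α

⟦paramAsHead⟧ : ∀ R x s → ⟦ paramAsHead R ⟧ (λ _ → s) 0ℚ ≡ ⟦ R ⟧ x s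
⟦paramAsHead⟧ (_ , β , α) x s =
  trans (cong₂ _+_ (+-identityʳ (β * s)) (+-identityˡ α)) (sym (+-identityˡ _))

-- After elimination the feasible `s` are cut out by finitely many non-strict bounds. They form a
-- closed interval, so a least nonnegative one is attained and is rational.
minimise : (L : List (Row d)) → ∀ {x₀ s₀} → Sat L x₀ s₀ → 0ℚ ≤ s₀ →
  ∃ λ s → 0ℚ ≤ s × (∃ λ x → Sat L x s) × (∀ y t → 0ℚ ≤ t → Sat L y t → s ≤ t)
minimise L {x₀} {s₀} sat₀ 0≤s₀ = s , ⊥≤max 0ℚ lows , from (sat⇔′ s) feasible , minimal
  where
  L′ = proj₁ (eliminate L)
  open HeadBounds (headBounds (map paramAsHead L′))
  value : Row 0 → ℚ
  value R = ⟦ R ⟧ (λ ()) 0ℚ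
  lows = map value lower
  -- The starting value 0 enforces `0ℚ ≤ s` and is itself the minimum when no lower bound is
  -- positive.
  s = max 0ℚ lows

  satLine : ∀ t → Sat L′ (λ ()) t ⇔ Sat (map paramAsHead L′) (λ _ → t) 0ℚ
  satLine t = mk⇔
    (λ h → map⁺ (All.map (λ {R} → subst (0ℚ ≤_) (sym (⟦paramAsHead⟧ R (λ ()) t))) h))
    (λ h → All.map (λ {R} → subst (0ℚ ≤_) (⟦paramAsHead⟧ R (λ ()) t)) (map⁻ h))

  sat⇔′ : ∀ t → (∃ λ x → Sat L x t) ⇔
    (Sat free (λ ()) 0ℚ × All (λ R → value R ≤ t) lower × All (λ R → t ≤ value R) upper)
  sat⇔′ t = mk⇔
    (λ h → to (sat⇔ (λ _ → t) 0ℚ) (to (satLine t) (to (proj₂ (eliminate L) t) h)))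
    (λ h → from (proj₂ (eliminate L) t) (from (satLine t) (from (sat⇔ (λ _ → t) 0ℚ) h)))

  minimal : ∀ y t → 0ℚ ≤ t → Sat L y t → s ≤ t
  minimal y t 0≤t h = max≤v⁺ 0≤t (map⁺ (proj₁ (proj₂ (to (sat⇔′ t) (y , h)))))

  feasible : Sat free (λ ()) 0ℚ × All (λ R → value R ≤ s) lower × All (λ R → s ≤ value R) upper
  -- The free rows do not involve the parameter, and the upper bounds pass from `s₀` down to `s`
  -- because `s ≤ s₀`.
  feasible = let f , _ , u = to (sat⇔′ s₀) (x₀ , sat₀) in
    f , map⁻ (xs≤max 0ℚ lows) , All.map (≤-trans (minimal x₀ s₀ 0≤s₀ sat₀)) u

-- Integral solutions of covering programs

-- The laws of `ℕ→ℚ` are checked on unnormalised fractions, where the denominator 1 is literal and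
-- no gcd intervenes.
natᵘ : ℕ → ℚᵘ
natᵘ m = mkℚᵘ (ℤ.+ m) 0

toℚᵘ-ℕ→ℚ : ∀ m → toℚᵘ (ℕ→ℚ m) ℚᵘ.≃ natᵘ m
toℚᵘ-ℕ→ℚ m = toℚᵘ-fromℚᵘ (natᵘ m)

ℕ→ℚ-+ : ∀ a b → ℕ→ℚ (a ℕ.+ b) ≡ ℕ→ℚ a + ℕ→ℚ b
ℕ→ℚ-+ a b = toℚᵘ-injective (begin
  toℚᵘ (ℕ→ℚ (a ℕ.+ b))                ≈⟨ toℚᵘ-ℕ→ℚ (a ℕ.+ b) ⟩
  natᵘ (a ℕ.+ b)                      ≈⟨ *≡* (cong (ℤ._* ℤ.+ 1)
                                           (sym (cong₂ ℤ._+_ (ℤ.*-identityʳ (ℤ.+ a)) (ℤ.*-identityʳ (ℤ.+ b))))) ⟩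
  natᵘ a ℚᵘ.+ natᵘ b                  ≈⟨ ℚᵘ.+-cong (ℚᵘ.≃-sym (toℚᵘ-ℕ→ℚ a)) (ℚᵘ.≃-sym (toℚᵘ-ℕ→ℚ b)) ⟩
  toℚᵘ (ℕ→ℚ a) ℚᵘ.+ toℚᵘ (ℕ→ℚ b)      ≈⟨ ℚᵘ.≃-sym (toℚᵘ-homo-+ (ℕ→ℚ a) (ℕ→ℚ b)) ⟩
  toℚᵘ (ℕ→ℚ a + ℕ→ℚ b)                ∎)
  where open ℚᵘ.≃-Reasoning

ℕ→ℚ-* : ∀ a b → ℕ→ℚ (a ℕ.* b) ≡ ℕ→ℚ a * ℕ→ℚ b
ℕ→ℚ-* a b = toℚᵘ-injective (begin
  toℚᵘ (ℕ→ℚ (a ℕ.* b))                ≈⟨ toℚᵘ-ℕ→ℚ (a ℕ.* b) ⟩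
  natᵘ (a ℕ.* b)                      ≈⟨ *≡* (cong (ℤ._* ℤ.+ 1) (ℤ.pos-* a b)) ⟩
  natᵘ a ℚᵘ.* natᵘ b                  ≈⟨ ℚᵘ.*-cong (ℚᵘ.≃-sym (toℚᵘ-ℕ→ℚ a)) (ℚᵘ.≃-sym (toℚᵘ-ℕ→ℚ b)) ⟩
  toℚᵘ (ℕ→ℚ a) ℚᵘ.* toℚᵘ (ℕ→ℚ b)      ≈⟨ ℚᵘ.≃-sym (toℚᵘ-homo-* (ℕ→ℚ a) (ℕ→ℚ b)) ⟩
  toℚᵘ (ℕ→ℚ a * ℕ→ℚ b)                ∎)
  where open ℚᵘ.≃-Reasoning

ℕ→ℚ-mono-≤ : ∀ {a b} → a ℕ.≤ b → ℕ→ℚ a ≤ ℕ→ℚ b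
ℕ→ℚ-mono-≤ {a} {b} a≤b = toℚᵘ-cancel-≤ (begin
  toℚᵘ (ℕ→ℚ a)  ≃⟨ toℚᵘ-ℕ→ℚ a ⟩
  natᵘ a        ≤⟨ *≤* (ℤ.*-monoʳ-≤-nonNeg (ℤ.+ 1) (ℤ.+≤+ a≤b)) ⟩
  natᵘ b        ≃⟨ ℚᵘ.≃-sym (toℚᵘ-ℕ→ℚ b) ⟩
  toℚᵘ (ℕ→ℚ b)  ∎)
  where open ℚᵘ.≤-Reasoning

ℕ→ℚ-cancel-≤ : ∀ {a b} → ℕ→ℚ a ≤ ℕ→ℚ b → a ℕ.≤ b
ℕ→ℚ-cancel-≤ {a} {b} h = ℤ.drop‿+≤+ (ℤ.*-cancelʳ-≤-pos (ℤ.+ a) (ℤ.+ b) (ℤ.+ 1) (ℚᵘ.drop-*≤* (begin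
  natᵘ a        ≃⟨ ℚᵘ.≃-sym (toℚᵘ-ℕ→ℚ a) ⟩
  toℚᵘ (ℕ→ℚ a)  ≤⟨ toℚᵘ-mono-≤ h ⟩
  toℚᵘ (ℕ→ℚ b)  ≃⟨ toℚᵘ-ℕ→ℚ b ⟩
  natᵘ b        ∎)))
  where open ℚᵘ.≤-Reasoning

0≤ℕ→ℚ : ∀ a → 0ℚ ≤ ℕ→ℚ a
0≤ℕ→ℚ a = ℕ→ℚ-mono-≤ {0} {a} z≤n

ℕ→ℚ-pos : ∀ a → Positive (ℕ→ℚ (suc a))
ℕ→ℚ-pos a = normalize-pos (suc a) 1

ℕ→ℚ-sum : ∀ (f : Vector ℕ d) → ℕ→ℚ (Σℕ.sum f) ≡ Σℚ.sum (ℕ→ℚ ∘ f)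
ℕ→ℚ-sum {zero}  f = refl
ℕ→ℚ-sum {suc _} f = trans (ℕ→ℚ-+ (f zero) (Σℕ.sum (f ∘ suc)))
  (cong (ℕ→ℚ (f zero) +_) (ℕ→ℚ-sum (f ∘ suc)))

ℕ→ℚ-∙ : ∀ (a x : Vector ℕ d) → ℕ→ℚ (Σℕ.sum λ i → a i ℕ.* x i) ≡ (ℕ→ℚ ∘ a) ∙ (ℕ→ℚ ∘ x)
ℕ→ℚ-∙ a x = trans (ℕ→ℚ-sum λ i → a i ℕ.* x i) (Σℚ.sum-cong-≗ λ i → ℕ→ℚ-* (a i) (x i))

-- If `K` is c times the denominator of `q`, the witness is c times its numerator. A negative
-- numerator is ruled out by `0ℚ ≤ q`.
clearDenominator : ∀ {K} q → 0ℚ ≤ q → ↧ₙ q ∣ K → ∃ λ X → ℕ→ℚ X ≡ ℕ→ℚ K * q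
clearDenominator (mkℚ ℤ.-[1+ _ ] _ _) (*≤* ()) _
clearDenominator q@(mkℚ (ℤ.+ p) d _) _ (divides c refl) = c ℕ.* p , toℚᵘ-injective (begin
  toℚᵘ (ℕ→ℚ (c ℕ.* p))                   ≈⟨ toℚᵘ-ℕ→ℚ (c ℕ.* p) ⟩
  natᵘ (c ℕ.* p)                         ≈⟨ *≡* (cross c p (suc d)) ⟩
  natᵘ (c ℕ.* suc d) ℚᵘ.* toℚᵘ q         ≈⟨ ℚᵘ.*-cong (ℚᵘ.≃-sym (toℚᵘ-ℕ→ℚ (c ℕ.* suc d)))
                                                           (ℚᵘ.≃-refl {toℚᵘ q}) ⟩
  toℚᵘ (ℕ→ℚ (c ℕ.* suc d)) ℚᵘ.* toℚᵘ q   ≈⟨ ℚᵘ.≃-sym (toℚᵘ-homo-* (ℕ→ℚ (c ℕ.* suc d)) q) ⟩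
  toℚᵘ (ℕ→ℚ (c ℕ.* suc d) * q)           ∎)
  where
  open ℚᵘ.≃-Reasoning
  cross : ∀ c p e → ℤ.+ (c ℕ.* p) ℤ.* ℤ.+ (1 ℕ.* e) ≡ (ℤ.+ (c ℕ.* e) ℤ.* ℤ.+ p) ℤ.* ℤ.+ 1
  cross c p e = trans (sym (ℤ.pos-* (c ℕ.* p) (1 ℕ.* e)))
    (trans (cong ℤ.+_ (ℕS.solve 3 (λ c p e →
        (c ℕS.:* p) ℕS.:* (ℕS.con 1 ℕS.:* e) ℕS.:= (c ℕS.:* e ℕS.:* p) ℕS.:* ℕS.con 1) refl c p e))
      (trans (ℤ.pos-* (c ℕ.* e ℕ.* p) 1) (cong (ℤ._* ℤ.+ 1) (ℤ.pos-* (c ℕ.* e) p))))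

commonMultiple : ∀ (f : Vector ℕ d) → (∀ i → 1 ℕ.≤ f i) → ∃ λ K → 1 ℕ.≤ K × (∀ i → f i ∣ K)
commonMultiple {zero}  f f≥1 = 1 , ℕ.≤-refl , λ ()
commonMultiple {suc _} f f≥1 =
  let K , K≥1 , f∣K = commonMultiple (f ∘ suc) (f≥1 ∘ suc) in
  f zero ℕ.* K , ℕ.*-mono-≤ (f≥1 zero) K≥1 ,
  λ { zero → m∣m*n K ; (suc i) → ∣n⇒∣m*n (f zero) (f∣K i) }

∙-scaleʳ : ∀ k (c x : Vector ℚ d) → c ∙ (λ i → k * x i) ≡ k * (c ∙ x)
∙-scaleʳ k c x = trans
  (Σℚ.sum-cong-≗ λ i → solve 3 (λ k c x → c :* (k :* x) := k :* (c :* x)) refl k (c i) (x i))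
  (sym (Σℚ.*-distribˡ-sum k λ i → c i * x i))

0ᵛ-∙ : ∀ (x : Vector ℚ d) → (λ _ → 0ℚ) ∙ x ≡ 0ℚ
0ᵛ-∙ {zero}  x = refl
0ᵛ-∙ {suc _} x = trans (cong₂ _+_ (*-zeroˡ (x zero)) (0ᵛ-∙ (x ∘ suc))) (+-identityˡ 0ℚ)

δ-∙ : ∀ i (x : Vector ℚ d) → (ℕ→ℚ ∘ δ i) ∙ x ≡ x i
δ-∙ zero x = trans (cong₂ _+_ (*-identityˡ (x zero)) (0ᵛ-∙ (x ∘ suc))) (+-identityʳ (x zero))
δ-∙ (suc i) x = trans (cong₂ _+_ (*-zeroˡ (x zero)) (δ-∙ i (x ∘ suc))) (+-identityˡ (x (suc i)))

-1ᵛ-∙ : ∀ (x : Vector ℚ d) → (λ _ → - 1ℚ) ∙ x ≡ - Σℚ.sum x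
-1ᵛ-∙ {zero}  x = refl
-1ᵛ-∙ {suc _} x = trans
  (cong₂ _+_ (trans (sym (neg-distribˡ-* 1ℚ (x zero))) (cong -_ (*-identityˡ (x zero)))) (-1ᵛ-∙ (x ∘ suc)))
  (sym (neg-distrib-+ (x zero) (Σℚ.sum (x ∘ suc))))

-- The covering program and its optimum

module Covering {m : ℕ} (A : Fin m → Vector ℕ d) (b : Vector ℕ m) where

  -- The objective is turned into a constraint with budget `s`, so that minimising the sum becomes
  -- minimising the one parameter that elimination leaves.
  Feasible : Vector ℚ d → ℚ → Set
  Feasible x s = (∀ r → ℕ→ℚ (b r) ≤ (ℕ→ℚ ∘ A r) ∙ x) × (∀ i → 0ℚ ≤ x i) × Σℚ.sum x ≤ s

  covers : Fin m → Row d
  covers r = ℕ→ℚ ∘ A r , 0ℚ , - ℕ→ℚ (b r)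

  nonNegs : Fin d → Row d
  nonNegs i = ℕ→ℚ ∘ δ i , 0ℚ , 0ℚ

  budget : Row d
  budget = (λ _ → - 1ℚ) , 1ℚ , 0ℚ

  rows : List (Row d)
  rows = budget ∷ tabulate covers ++ tabulate nonNegs

  ⟦covers⟧ : ∀ r x s → ⟦ covers r ⟧ x s ≡ (ℕ→ℚ ∘ A r) ∙ x - ℕ→ℚ (b r)
  ⟦covers⟧ r x s = cong ((ℕ→ℚ ∘ A r) ∙ x +_)
    (trans (cong (_- ℕ→ℚ (b r)) (*-zeroˡ s)) (+-identityˡ (- ℕ→ℚ (b r))))

  ⟦nonNegs⟧ : ∀ i x s → ⟦ nonNegs i ⟧ x s ≡ x i
  ⟦nonNegs⟧ i x s = trans (cong₂ _+_ (δ-∙ i x) (trans (cong (_+ 0ℚ) (*-zeroˡ s)) (+-identityˡ 0ℚ)))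
    (+-identityʳ (x i))

  ⟦budget⟧ : ∀ x s → ⟦ budget ⟧ x s ≡ s - Σℚ.sum x
  ⟦budget⟧ x s = trans
    (cong₂ _+_ (-1ᵛ-∙ x) (trans (+-identityʳ (1ℚ * s)) (*-identityˡ s)))
    (+-comm (- Σℚ.sum x) s)

  sat⇔feasible : ∀ x s → Sat rows x s ⇔ Feasible x s
  sat⇔feasible x s = mk⇔
    (λ { (h ∷ hs) →
      (λ r → 0≤q-p⇒p≤q (subst (0ℚ ≤_) (⟦covers⟧ r x s) (tabulate⁻ (++⁻ˡ (tabulate covers) hs) r))) ,
      (λ i → subst (0ℚ ≤_) (⟦nonNegs⟧ i x s) (tabulate⁻ (++⁻ʳ (tabulate covers) hs) i)) ,
      0≤q-p⇒p≤q (subst (0ℚ ≤_) (⟦budget⟧ x s) h) })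
    (λ (c , p , h) → subst (0ℚ ≤_) (sym (⟦budget⟧ x s)) (p≤q⇒0≤q-p h) ∷
      ++⁺ (tabulate⁺ λ r → subst (0ℚ ≤_) (sym (⟦covers⟧ r x s)) (p≤q⇒0≤q-p (c r)))
          (tabulate⁺ λ i → subst (0ℚ ≤_) (sym (⟦nonNegs⟧ i x s)) (p i)))

  -- An integral form of the rational optimum: `X` is a minimiser multiplied by a common denominator
  -- `K`. Taking `minimal` at `K` and `X` shows that `sum≤` is in fact an equality.
  record Optimum : Set where
    field
      q       : ℚ
      0≤q     : 0ℚ ≤ q
      K       : ℕ
      1≤K     : 1 ℕ.≤ K
      X       : Vector ℕ d
      covered : ∀ r → K ℕ.* b r ℕ.≤ Σℕ.sum λ i → A r i ℕ.* X i
      sum≤    : ℕ→ℚ (Σℕ.sum X) ≤ q * ℕ→ℚ K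
      minimal : ∀ t Y → (∀ r → t ℕ.* b r ℕ.≤ Σℕ.sum λ i → A r i ℕ.* Y i) →
                q * ℕ→ℚ t ≤ ℕ→ℚ (Σℕ.sum Y)

  -- Supplies the feasible starting point that `minimise` requires.
  ones-feasible : (∀ r → b r ℕ.≤ Σℕ.sum (A r)) → Feasible (λ _ → 1ℚ) (Σℚ.sum {d} λ _ → 1ℚ)
  ones-feasible b≤A = (λ r → ≤-trans (ℕ→ℚ-mono-≤ (b≤A r)) (≤-reflexive
      (trans (ℕ→ℚ-sum (A r)) (Σℚ.sum-cong-≗ λ i → sym (*-identityʳ (ℕ→ℚ (A r i)))))))
    , (λ _ → 0≤ℕ→ℚ 1) , ≤-refl

  -- Constraints and objective are homogeneous, so dividing an integral solution at level `suc t` by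
  -- `suc t` gives a rational point at level 1, to which the minimality of the optimum applies.
  scaled-feasible : ∀ t Y → (∀ r → suc t ℕ.* b r ℕ.≤ Σℕ.sum λ i → A r i ℕ.* Y i) →
    let instance _ = pos⇒nonZero (ℕ→ℚ (suc t)) {{ℕ→ℚ-pos t}} ; k = 1/ ℕ→ℚ (suc t) in
    Feasible (λ i → k * ℕ→ℚ (Y i)) (k * ℕ→ℚ (Σℕ.sum Y))
  scaled-feasible t Y h = (λ r → begin
      ℕ→ℚ (b r)                                       ≡⟨ sym (*-identityˡ (ℕ→ℚ (b r))) ⟩
      1ℚ * ℕ→ℚ (b r)                                  ≡⟨ cong (_* ℕ→ℚ (b r)) (sym (*-inverseˡ τ)) ⟩
      k * τ * ℕ→ℚ (b r)                               ≡⟨ *-assoc k τ (ℕ→ℚ (b r)) ⟩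
      k * (τ * ℕ→ℚ (b r))                             ≡⟨ cong (k *_) (sym (ℕ→ℚ-* (suc t) (b r))) ⟩
      k * ℕ→ℚ (suc t ℕ.* b r)                         ≤⟨ *-monoˡ-≤-nonNeg k (ℕ→ℚ-mono-≤ (h r)) ⟩
      k * ℕ→ℚ (Σℕ.sum λ i → A r i ℕ.* Y i)            ≡⟨ cong (k *_) (ℕ→ℚ-∙ (A r) Y) ⟩
      k * ((ℕ→ℚ ∘ A r) ∙ (ℕ→ℚ ∘ Y))                   ≡⟨ sym (∙-scaleʳ k (ℕ→ℚ ∘ A r) (ℕ→ℚ ∘ Y)) ⟩
      (ℕ→ℚ ∘ A r) ∙ (λ i → k * ℕ→ℚ (Y i))             ∎)
    , (λ i → subst (_≤ k * ℕ→ℚ (Y i)) (*-zeroʳ k) (*-monoˡ-≤-nonNeg k (0≤ℕ→ℚ (Y i))))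
    , ≤-reflexive (trans (sym (Σℚ.*-distribˡ-sum k (ℕ→ℚ ∘ Y))) (cong (k *_) (sym (ℕ→ℚ-sum Y))))
    where
    open ≤-Reasoning
    τ = ℕ→ℚ (suc t)
    instance
      τ-pos : Positive τ
      τ-pos = ℕ→ℚ-pos t
      τ-nonZero : NonZero τ
      τ-nonZero = pos⇒nonZero τ
    k = 1/ τ
    instance
      k-nonNeg : NonNegative k
      k-nonNeg = pos⇒nonNeg k {{1/pos⇒pos τ}}

  optimum : (∀ r → b r ℕ.≤ Σℕ.sum (A r)) → Optimum
  optimum b≤A = record
    { q = q ; 0≤q = 0≤q ; K = K ; 1≤K = 1≤K ; X = X
    ; covered = λ r → ℕ→ℚ-cancel-≤ (begin
        ℕ→ℚ (K ℕ.* b r)                     ≡⟨ ℕ→ℚ-* K (b r) ⟩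
        k * ℕ→ℚ (b r)                       ≤⟨ *-monoˡ-≤-nonNeg k (proj₁ x-feasible r) ⟩
        k * ((ℕ→ℚ ∘ A r) ∙ x)               ≡⟨ sym (∙-scaleʳ k (ℕ→ℚ ∘ A r) x) ⟩
        (ℕ→ℚ ∘ A r) ∙ (λ i → k * x i)       ≡⟨ Σℚ.sum-cong-≗ (λ i → cong (ℕ→ℚ (A r i) *_) (sym (X≡ i))) ⟩
        (ℕ→ℚ ∘ A r) ∙ (ℕ→ℚ ∘ X)             ≡⟨ sym (ℕ→ℚ-∙ (A r) X) ⟩
        ℕ→ℚ (Σℕ.sum λ i → A r i ℕ.* X i)    ∎)
    ; sum≤ = begin
        ℕ→ℚ (Σℕ.sum X)            ≡⟨ ℕ→ℚ-sum X ⟩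
        Σℚ.sum (ℕ→ℚ ∘ X)          ≡⟨ Σℚ.sum-cong-≗ X≡ ⟩
        Σℚ.sum (λ i → k * x i)    ≡⟨ sym (Σℚ.*-distribˡ-sum k x) ⟩
        k * Σℚ.sum x              ≤⟨ *-monoˡ-≤-nonNeg k (proj₂ (proj₂ x-feasible)) ⟩
        k * q                     ≡⟨ *-comm k q ⟩
        q * k                     ∎
    ; minimal = min′
    }
    where
    open ≤-Reasoning
    ones = ones-feasible b≤A
    0≤s₀ : 0ℚ ≤ Σℚ.sum {d} λ _ → 1ℚ
    0≤s₀ = subst (0ℚ ≤_) (ℕ→ℚ-sum {d} λ _ → 1) (0≤ℕ→ℚ (Σℕ.sum {d} λ _ → 1))
    opt = minimise rows (from (sat⇔feasible _ _) ones) 0≤s₀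
    q = proj₁ opt
    0≤q = proj₁ (proj₂ opt)
    x = proj₁ (proj₁ (proj₂ (proj₂ opt)))
    x-feasible : Feasible x q
    x-feasible = to (sat⇔feasible x q) (proj₂ (proj₁ (proj₂ (proj₂ opt))))
    common = commonMultiple (λ i → ↧ₙ (x i)) (λ i → s≤s z≤n)
    K = proj₁ common
    1≤K = proj₁ (proj₂ common)
    k = ℕ→ℚ K
    instance
      k-nonNeg : NonNegative k
      k-nonNeg = nonNegative (0≤ℕ→ℚ K)
    cleared : ∀ i → ∃ λ Z → ℕ→ℚ Z ≡ k * x i
    cleared i = clearDenominator (x i) (proj₁ (proj₂ x-feasible) i) (proj₂ (proj₂ common) i)
    X : Vector ℕ d
    X i = proj₁ (cleared i)
    X≡ : ∀ i → ℕ→ℚ (X i) ≡ k * x i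
    X≡ i = proj₂ (cleared i)
    min′ : ∀ t Y → (∀ r → t ℕ.* b r ℕ.≤ Σℕ.sum λ i → A r i ℕ.* Y i) → q * ℕ→ℚ t ≤ ℕ→ℚ (Σℕ.sum Y)
    -- Level 0 admits no division, but there the claimed bound is just 0.
    min′ zero    Y h = subst (_≤ ℕ→ℚ (Σℕ.sum Y)) (sym (*-zeroʳ q)) (0≤ℕ→ℚ (Σℕ.sum Y))
    min′ (suc t) Y h = begin
      q * τ             ≤⟨ *-monoʳ-≤-nonNeg τ q≤ ⟩
      1/ τ * S * τ      ≡⟨ solve 3 (λ i s t → i :* s :* t := i :* t :* s) refl (1/ τ) S τ ⟩
      1/ τ * τ * S      ≡⟨ cong (_* S) (*-inverseˡ τ) ⟩
      1ℚ * S            ≡⟨ *-identityˡ S ⟩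
      S                 ∎
      where
      τ = ℕ→ℚ (suc t)
      S = ℕ→ℚ (Σℕ.sum Y)
      instance
        τ-pos : Positive τ
        τ-pos = ℕ→ℚ-pos t
        τ-nonZero : NonZero τ
        τ-nonZero = pos⇒nonZero τ
        τ-nonNeg : NonNegative τ
        τ-nonNeg = pos⇒nonNeg τ
        i-nonNeg : NonNegative (1/ τ)
        i-nonNeg = pos⇒nonNeg (1/ τ) {{1/pos⇒pos τ}}
      q≤ : q ≤ 1/ τ * S
      q≤ = proj₂ (proj₂ (proj₂ opt)) _ _
        (subst (_≤ 1/ τ * S) (*-zeroʳ (1/ τ)) (*-monoˡ-≤-nonNeg (1/ τ) (0≤ℕ→ℚ (Σℕ.sum Y))))
        (from (sat⇔feasible _ _) (scaled-feasible t Y h))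

-- Pebbling

module Pebbling (G : Graph) where

  private
    V = Fin (n G)
  variable
    D E F H : Distribution G

  -- Reaching at least a given distribution

  infix 4 _≼_ _⇝_
  infixl 6 _⊕_
  infixr 7 _⊛_

  _≼_ : Distribution G → Distribution G → Set
  D ≼ E = ∀ w → D w ℕ.≤ E w

  _⊕_ : Distribution G → Distribution G → Distribution G
  (D ⊕ E) w = D w ℕ.+ E w

  _⊛_ : ℕ → Distribution G → Distribution G
  (k ⊛ D) w = k ℕ.* D w

  -- Written additively, a move is a linear identity without truncated subtraction. Both the frame
  -- argument and the weight argument then follow by cancelling `2 ℕ.* δ u`.
  move-≡ : ∀ {u v} → ¬ u ≡ v → 2 ℕ.≤ D u → ∀ w →
    move G D u v w ℕ.+ 2 ℕ.* δ u w ≡ D w ℕ.+ δ v w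
  move-≡ {D} {u} {v} u≢v 2≤Du w with w ≟ u | w ≟ v
  ... | yes refl | _ rewrite δ-refl u | δ-≢ (u≢v ∘ sym) =
    trans (ℕ.m∸n+n≡m 2≤Du) (sym (ℕ.+-identityʳ (D u)))
  ... | no w≢u | yes refl rewrite δ-refl v | δ-≢ (w≢u ∘ sym) =
    trans (ℕ.+-identityʳ _) (ℕ.+-comm 1 (D v))
  ... | no w≢u | no w≢v rewrite δ-≢ (w≢u ∘ sym) | δ-≢ (w≢v ∘ sym) = refl

  adj⇒≢ : ∀ {u v} → T (adj G u v) → ¬ u ≡ v
  adj⇒≢ {u} e refl = subst T (irrefl G u) e

  -- `E` has at least as many pebbles on `u` as `D`, so the move stays legal; it changes `D` and `E`
  -- by the same amounts, and `F` is a bystander.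
  step-frame : ∀ {u v} → T (adj G u v) → 2 ℕ.≤ D u → D ⊕ F ≼ E →
    2 ℕ.≤ E u × move G D u v ⊕ F ≼ move G E u v
  step-frame {D} {F} {E} {u} {v} e 2≤Du D⊕F≼E = 2≤Eu , λ w →
    ℕ.+-cancelʳ-≤ (2 ℕ.* δ u w) _ _ (begin
      move G D u v w ℕ.+ F w ℕ.+ 2 ℕ.* δ u w    ≡⟨ rearrange (move G D u v w) (F w) (2 ℕ.* δ u w) ⟩
      move G D u v w ℕ.+ 2 ℕ.* δ u w ℕ.+ F w    ≡⟨ cong (ℕ._+ F w) (move-≡ {D} u≢v 2≤Du w) ⟩
      D w ℕ.+ δ v w ℕ.+ F w                     ≡⟨ rearrange (D w) (δ v w) (F w) ⟩
      D w ℕ.+ F w ℕ.+ δ v w                     ≤⟨ ℕ.+-monoˡ-≤ (δ v w) (D⊕F≼E w) ⟩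
      E w ℕ.+ δ v w                             ≡⟨ sym (move-≡ {E} u≢v 2≤Eu w) ⟩
      move G E u v w ℕ.+ 2 ℕ.* δ u w            ∎)
    where
    open ℕ.≤-Reasoning
    u≢v = adj⇒≢ e
    2≤Eu = ℕ.≤-trans 2≤Du (ℕ.≤-trans (ℕ.m≤m+n (D u) (F u)) (D⊕F≼E u))
    rearrange : ∀ a b c → a ℕ.+ b ℕ.+ c ≡ a ℕ.+ c ℕ.+ b
    rearrange a b c = trans (ℕ.+-assoc a b c) (trans (cong (a ℕ.+_) (ℕ.+-comm b c)) (sym (ℕ.+-assoc a c b)))

  reach-frame : ∀ {D D′ E} F → Reachable G D D′ → D ⊕ F ≼ E →
    ∃ λ E′ → Reachable G E E′ × D′ ⊕ F ≼ E′
  reach-frame F ε D⊕F≼E = _ , ε , D⊕F≼E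
  reach-frame {D} {E = E} F (step u v e 2≤Du ◅ p) D⊕F≼E =
    let 2≤Eu , le = step-frame {D} {F} {E} e 2≤Du D⊕F≼E
        E′ , q , le′ = reach-frame F p le
    in E′ , step u v e 2≤Eu ◅ q , le′

  -- Surplus pebbles may be forgotten. This makes the relation transitive and compatible with sums
  -- and multiples, so pebbling can be argued by linear algebra.
  _⇝_ : Distribution G → Distribution G → Set
  D ⇝ F = ∃ λ E → Reachable G D E × F ≼ E

  ≽⇒⇝ : F ≼ D → D ⇝ F
  ≽⇒⇝ F≼D = _ , ε , F≼D

  ⇝-trans : D ⇝ E → E ⇝ F → D ⇝ F
  ⇝-trans (D′ , p , E≼D′) (E′ , q , F≼E′) =
    -- With the zero distribution as bystander, the frame property is plain monotonicity.
    let D″ , r , le = reach-frame (λ _ → 0) q (λ w → ℕ.≤-trans (ℕ.≤-reflexive (ℕ.+-identityʳ _)) (E≼D′ w))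
    in D″ , p ◅◅ r , λ w → ℕ.≤-trans (F≼E′ w) (ℕ.≤-trans (ℕ.≤-reflexive (sym (ℕ.+-identityʳ _))) (le w))

  ⇝-⊕ʳ : ∀ H → D ⇝ E → D ⊕ H ⇝ E ⊕ H
  ⇝-⊕ʳ H (D′ , p , E≼D′) =
    let D″ , r , le = reach-frame H p (λ _ → ℕ.≤-refl)
    in D″ , r , λ w → ℕ.≤-trans (ℕ.+-monoˡ-≤ (H w) (E≼D′ w)) (le w)

  -- The two sequences are run one after the other, each with the other summand as bystander.
  ⇝-⊕ : D ⇝ E → F ⇝ H → D ⊕ F ⇝ E ⊕ H
  ⇝-⊕ {D} {E} {F} {H} p q = ⇝-trans (⇝-⊕ʳ F p) (⇝-trans (≽⇒⇝ (comm E F))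
    (⇝-trans (⇝-⊕ʳ E q) (≽⇒⇝ (comm H E))))
    where
    comm : ∀ A B → B ⊕ A ≼ A ⊕ B
    comm A B w = ℕ.≤-reflexive (ℕ.+-comm (B w) (A w))

  ⇝-⊛ : ∀ k → D ⇝ E → k ⊛ D ⇝ k ⊛ E
  ⇝-⊛ zero    p = ≽⇒⇝ λ _ → z≤n
  ⇝-⊛ (suc k) p = ⇝-⊕ p (⇝-⊛ k p)

  ⨁ : ∀ {k} → (Fin k → Distribution G) → Distribution G
  ⨁ Ds w = Σℕ.sum λ i → Ds i w

  ⇝-⨁ : ∀ {k} {Ds Es : Fin k → Distribution G} → (∀ i → Ds i ⇝ Es i) → ⨁ Ds ⇝ ⨁ Es
  ⇝-⨁ {zero}  p = ≽⇒⇝ λ _ → z≤n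
  ⇝-⨁ {suc _} p = ⇝-⊕ (p zero) (⇝-⨁ (p ∘ suc))

  edge-⇝ : ∀ {u v} → T (adj G u v) → 2 ⊛ δ u ⇝ δ v
  edge-⇝ {u} {v} e = move G (2 ⊛ δ u) u v , step u v e 2≤ ◅ ε , λ w →
    ℕ.+-cancelʳ-≤ (2 ℕ.* δ u w) _ _ (ℕ.≤-reflexive
      (trans (ℕ.+-comm (δ v w) _) (sym (move-≡ {2 ⊛ δ u} (adj⇒≢ e) 2≤ w))))
    where
    2≤ : 2 ℕ.≤ (2 ⊛ δ u) u
    2≤ = ℕ.≤-reflexive (cong (2 ℕ.*_) (sym (δ-refl u)))

  -- Weights that moves cannot increase

  weight : (V → ℕ) → Distribution G → ℕ
  weight a D = Σℕ.sum λ w → a w ℕ.* D w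

  weight-⊕ : ∀ a D E → weight a (D ⊕ E) ≡ weight a D ℕ.+ weight a E
  weight-⊕ a D E = trans (Σℕ.sum-cong-≗ λ w → ℕ.*-distribˡ-+ (a w) (D w) (E w))
    (Σℕ.∑-distrib-+ (λ w → a w ℕ.* D w) (λ w → a w ℕ.* E w))

  -- A move from `u` to `v` loses weight `2 ℕ.* a u` and gains `a v`, so this is the condition that
  -- no move raises the total.
  Slow : (V → ℕ) → Set
  Slow a = ∀ u v → T (adj G u v) → a v ℕ.≤ 2 ℕ.* a u

  module _ {a : V → ℕ} (slow : Slow a) where

    step-weight : ∀ {D E} → Step G D E → weight a E ℕ.≤ weight a D
    step-weight {D} (step u v e 2≤Du) = ℕ.+-cancelʳ-≤ (weight a (2 ⊛ δ u)) _ _ (begin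
      weight a M ℕ.+ weight a (2 ⊛ δ u)  ≡⟨ sym (weight-⊕ a M (2 ⊛ δ u)) ⟩
      weight a (M ⊕ 2 ⊛ δ u)             ≡⟨ Σℕ.sum-cong-≗ (λ w →
                                              cong (a w ℕ.*_) (move-≡ {D} (adj⇒≢ e) 2≤Du w)) ⟩
      weight a (D ⊕ δ v)                 ≡⟨ weight-⊕ a D (δ v) ⟩
      weight a D ℕ.+ weight a (δ v)      ≤⟨ ℕ.+-monoʳ-≤ (weight a D) δ-slow ⟩
      weight a D ℕ.+ weight a (2 ⊛ δ u)  ∎)
      where
      open ℕ.≤-Reasoning
      M = move G D u v
      weight-δ : ∀ k u → weight a (k ⊛ δ u) ≡ k ℕ.* a u
      weight-δ k u = trans
        (Σℕ.sum-cong-≗ λ w → trans (cong (λ d → a w ℕ.* (k ℕ.* d)) (δ-sym u w))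
          (ℕS.solve 3 (λ x y z → x ℕS.:* (y ℕS.:* z) ℕS.:= (y ℕS.:* x) ℕS.:* z) refl (a w) k (δ w u)))
        (sum-δ (λ w → k ℕ.* a w) u)
      δ-slow : weight a (δ v) ℕ.≤ weight a (2 ⊛ δ u)
      δ-slow = begin
        weight a (δ v)      ≡⟨ Σℕ.sum-cong-≗ (λ w → cong (a w ℕ.*_) (sym (ℕ.*-identityˡ (δ v w)))) ⟩
        weight a (1 ⊛ δ v)  ≡⟨ weight-δ 1 v ⟩
        1 ℕ.* a v           ≡⟨ ℕ.*-identityˡ (a v) ⟩
        a v                 ≤⟨ slow u v e ⟩
        2 ℕ.* a u           ≡⟨ sym (weight-δ 2 u) ⟩
        weight a (2 ⊛ δ u)  ∎

    reach-weight : ∀ {D E} → Reachable G D E → weight a E ℕ.≤ weight a D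
    reach-weight ε       = ℕ.≤-refl
    reach-weight (s ◅ p) = ℕ.≤-trans (reach-weight p) (step-weight s)

    solvable-weight : ∀ {D t r} → Solvable G t D → t ℕ.* a r ℕ.≤ weight a D
    solvable-weight {D} {t} {r} sol = let E , p , t≤Er = sol r in begin
      t ℕ.* a r    ≡⟨ ℕ.*-comm t (a r) ⟩
      a r ℕ.* t    ≤⟨ ℕ.*-monoʳ-≤ (a r) t≤Er ⟩
      a r ℕ.* E r  ≤⟨ term≤sum (λ w → a w ℕ.* E w) r ⟩
      weight a E   ≤⟨ reach-weight p ⟩
      weight a D   ∎
      where open ℕ.≤-Reasoning

  -- Weightings from breadth-first search

  record Weighting (r : V) : Set where
    field
      a     : V → ℕ
      a-pos   : 1 ℕ.≤ a r
      -- `slow` makes the weight inequality necessary for solvability; `gather` makes it sufficient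
      -- up to divisibility by `a r`.
      slow  : Slow a
      gather : ∀ v → a r ⊛ δ v ⇝ a v ⊛ δ r

  -- The weights after k rounds of breadth-first search from r, scaled by 2ᵏ:
  -- a vertex discovered in round j carries 2ᵏ⁻ʲ, an undiscovered one 0.
  record Stage (r : V) : Set where
    field
      a     : V → ℕ
      a-pos   : 1 ℕ.≤ a r
      tight : ∀ u v → T (adj G u v) → a v ℕ.≤ 1 ℕ.⊔ 2 ℕ.* a u
      gather : ∀ v → a r ⊛ δ v ⇝ a v ⊛ δ r

  Frontier : (V → ℕ) → V → Set
  Frontier a u = ∃ λ v → T (adj G u v) × 1 ℕ.≤ a v

  frontier? : ∀ a u → Dec (Frontier a u)
  frontier? a u = any? λ v → T? (adj G u v) ×-dec (1 ℕ.≤? a v)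

  bump : ∀ {Q : Set} → ℕ → Dec Q → ℕ
  bump (suc k) _       = 2 ℕ.* suc k
  bump zero    (yes _) = 1
  bump zero    (no _)  = 0

  -- The 1 in the bound allows for the frontier: a neighbour of an undiscovered vertex weighs at
  -- most 1. When that 1 doubles, the undiscovered vertex enters with weight 1, and the bound reads
  -- 2 ≤ 2. If both weights are positive, both double.
  bump-tight : ∀ {P Q : Set} p q (P? : Dec P) (Q? : Dec Q) → p ℕ.≤ 1 ℕ.⊔ 2 ℕ.* q →
    (1 ℕ.≤ p → Q) → bump p P? ℕ.≤ 1 ℕ.⊔ 2 ℕ.* bump q Q?
  bump-tight zero    q       (yes _) Q?      _   _ = ℕ.m≤m⊔n 1 (2 ℕ.* bump q Q?)
  bump-tight zero    q       (no _)  Q?      _   _ = z≤n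
  bump-tight (suc p) zero    P?      (yes _) (s≤s z≤n) _ = ℕ.≤-refl
  bump-tight (suc p) zero    P?      (no ¬Q) _   Q = contradiction (Q (s≤s z≤n)) ¬Q
  bump-tight (suc p) (suc q) P?      Q?      p≤q _ =
    ℕ.≤-trans (ℕ.*-monoʳ-≤ 2 p≤q) (ℕ.m≤n⊔m 1 (2 ℕ.* (2 ℕ.* suc q)))

  bump-≥ : ∀ {Q : Set} p (Q? : Dec Q) → p ℕ.≤ bump p Q?
  bump-≥ zero    Q? = z≤n
  bump-≥ (suc p) Q? = ℕ.m≤m+n (suc p) _

  bump-pos : ∀ {Q : Set} p (Q? : Dec Q) → 1 ℕ.≤ p → bump p Q? ≡ 2 ℕ.* p
  bump-pos (suc p) Q? _ = refl

  advance : ∀ {r} → Stage r → Stage r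
  advance {r} S = record
    { a = a′
    ; a-pos = ℕ.≤-trans a-pos (bump-≥ (a r) _)
    ; tight = λ u v e → bump-tight (a v) (a u) (frontier? a v) (frontier? a u) (tight u v e)
                          (λ 1≤av → v , e , 1≤av)
    ; gather = λ v → subst (λ k → k ⊛ δ v ⇝ a′ v ⊛ δ r) (sym (bump-pos (a r) _ a-pos))
                       (go v (a v) (frontier? a v) (gather v))
    }
    where
    open Stage S
    a′ : V → ℕ
    a′ u = bump (a u) (frontier? a u)
    go : ∀ v k (F? : Dec (Frontier a v)) → a r ⊛ δ v ⇝ k ⊛ δ r → (2 ℕ.* a r) ⊛ δ v ⇝ bump k F? ⊛ δ r
    go v (suc k) _ p = ⇝-trans (≽⇒⇝ λ w → ℕ.≤-reflexive (sym (ℕ.*-assoc 2 (a r) (δ v w))))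
      (⇝-trans (⇝-⊛ 2 p) (≽⇒⇝ λ w → ℕ.≤-reflexive (ℕ.*-assoc 2 (suc k) (δ r w))))
    go v zero (no _) _ = ≽⇒⇝ λ _ → z≤n
    -- For a newly discovered `v`, the doubled supply puts `a r` pebbles on its neighbour `u`, and
    -- gathering from there brings `a u`, hence at least one, to `r`.
    go v zero (yes (u , e , 1≤au)) _ =
      ⇝-trans (≽⇒⇝ λ w → ℕ.≤-reflexive (trans (sym (ℕ.*-assoc (a r) 2 (δ v w)))
                                          (cong (ℕ._* δ v w) (ℕ.*-comm (a r) 2))))
        (⇝-trans (⇝-⊛ (a r) (edge-⇝ e)) (⇝-trans (gather u)
          (≽⇒⇝ λ w → ℕ.*-monoˡ-≤ (δ r w) 1≤au)))

  -- Each term is 1 if the weight is 0 and 0 otherwise, so this counts the vertices of weight 0. It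
  -- is the termination measure of the search.
  undiscovered : (V → ℕ) → ℕ
  undiscovered a = Σℕ.sum λ v → 1 ℕ.∸ a v

  advance-< : ∀ {r} (S : Stage r) u → Stage.a S u ≡ 0 → Frontier (Stage.a S) u →
    undiscovered (Stage.a (advance S)) ℕ.< undiscovered (Stage.a S)
  advance-< S u au≡0 Fu = sum-mono-< (λ v → ℕ.∸-monoʳ-≤ 1 (bump-≥ (a v) (frontier? a v))) u
    (discovered (a u) (frontier? a u) au≡0)
    where
    open Stage S
    discovered : ∀ k (F? : Dec (Frontier a u)) → k ≡ 0 → 1 ℕ.∸ bump k F? ℕ.< 1 ℕ.∸ k
    discovered zero (yes _) _ = s≤s z≤n
    discovered zero (no ¬F) _ = contradiction Fu ¬F

  -- While some vertex of weight 0 has a discovered neighbour, another round lowers the count, which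
  -- `k` bounds. Once there is none, the exception in `tight` can no longer occur and `tight`
  -- becomes `slow`; other components keep weight 0.
  complete : ∀ {r} k (S : Stage r) → undiscovered (Stage.a S) ℕ.≤ k → Weighting r
  complete k S ≤k with any? (λ u → (Stage.a S u ℕ.≟ 0) ×-dec frontier? (Stage.a S) u)
  complete zero    S ≤k | yes (u , au≡0 , Fu) = contradiction (ℕ.<-≤-trans (advance-< S u au≡0 Fu) ≤k) λ ()
  complete (suc k) S ≤k | yes (u , au≡0 , Fu) =
    complete k (advance S) (ℕ.s≤s⁻¹ (ℕ.<-≤-trans (advance-< S u au≡0 Fu) ≤k))
  complete k       S ≤k | no none = record { a = a ; a-pos = a-pos ; slow = slow ; gather = gather }
    where
    open Stage S
    slow : Slow a
    slow u v e with a u in au | a v in av | tight u v e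
    ... | suc _ | _     | le = le
    ... | zero  | zero  | _  = z≤n
    ... | zero  | suc _ | _  = contradiction (u , au , v , e , subst (1 ℕ.≤_) (sym av) (s≤s z≤n)) none

  initial : ∀ r → Stage r
  initial r = record
    { a = δ r
    ; a-pos = ℕ.≤-reflexive (sym (δ-refl r))
    ; tight = λ u v e → ℕ.≤-trans (δ-≤1 r v) (ℕ.m≤m⊔n 1 (2 ℕ.* δ r u))
    ; gather = λ v → ≽⇒⇝ (gather₀ v)
    }
    where
    δ-≤1 : ∀ {k} (i j : Fin k) → δ i j ℕ.≤ 1
    δ-≤1 zero    zero    = ℕ.≤-refl
    δ-≤1 zero    (suc _) = z≤n
    δ-≤1 (suc _) zero    = z≤n
    δ-≤1 (suc i) (suc j) = δ-≤1 i j
    gather₀ : ∀ v → δ r v ⊛ δ r ≼ δ r r ⊛ δ v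
    gather₀ v with r ≟ v
    ... | yes refl = λ _ → ℕ.≤-refl
    ... | no r≢v rewrite δ-≢ r≢v = λ _ → z≤n

  weighting : ∀ r → Weighting r
  weighting r = complete _ (initial r) ℕ.≤-refl

  -- Sufficiency of the covering inequalities

  module _ {r : V} (𝒲 : Weighting r) where
    open Weighting 𝒲

    -- Each vertex `v` is gathered separately. Its pile consists of `c ℕ.* X v` full batches of
    -- `a r` pebbles, so nothing is lost to rounding.
    concentrate : ∀ c X → ((c ℕ.* a r) ⊛ X) ⇝ (c ℕ.* weight a X) ⊛ δ r
    concentrate c X = ⇝-trans (≽⇒⇝ split) (⇝-trans (⇝-⨁ λ v → ⇝-⊛ (c ℕ.* X v) (gather v)) (≽⇒⇝ merge))
      where
      split : ⨁ (λ v → (c ℕ.* X v) ⊛ (a r ⊛ δ v)) ≼ (c ℕ.* a r) ⊛ X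
      split w = ℕ.≤-reflexive (trans
        (Σℕ.sum-cong-≗ λ v → sym (ℕ.*-assoc (c ℕ.* X v) (a r) (δ v w)))
        (trans (sum-δ (λ v → c ℕ.* X v ℕ.* a r) w)
          (ℕS.solve 3 (λ c x y → c ℕS.:* x ℕS.:* y ℕS.:= c ℕS.:* y ℕS.:* x) refl c (X w) (a r))))
      merge : (c ℕ.* weight a X) ⊛ δ r ≼ ⨁ (λ v → (c ℕ.* X v) ⊛ (a v ⊛ δ r))
      merge w = ℕ.≤-reflexive (trans
        (ℕS.solve 3 (λ c s d → c ℕS.:* s ℕS.:* d ℕS.:= (c ℕS.:* d) ℕS.:* s) refl c (weight a X) (δ r w))
        (trans (Σℕ.*-distribˡ-sum (c ℕ.* δ r w) (λ v → a v ℕ.* X v))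
          (Σℕ.sum-cong-≗ λ v → ℕS.solve 4 (λ c d a x →
            (c ℕS.:* d) ℕS.:* (a ℕS.:* x) ℕS.:= (c ℕS.:* x) ℕS.:* (a ℕS.:* d)) refl c (δ r w) (a v) (X v))))

  size≡sum : ∀ D → size G D ≡ Σℕ.sum D
  size≡sum D = trans (cong sum (map-tabulate (λ v → v) D)) (sum-tabulate D)
    where
    sum-tabulate : ∀ {k} (f : Fin k → ℕ) → sum (tabulate f) ≡ Σℕ.sum f
    sum-tabulate {zero}  f = refl
    sum-tabulate {suc _} f = cong (f zero ℕ.+_) (sum-tabulate (f ∘ suc))

  module _ {r : V} (𝒲 : Weighting r) {K : ℕ} {X : Distribution G} where
    open Weighting 𝒲

    -- If `M` is c times `a r`, concentration leaves c times the weight of `X` on `r`, and the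
    -- covering inequality makes this at least `M ℕ.* K`.
    covered-reach : K ℕ.* a r ℕ.≤ weight a X → ∀ {M} → a r ∣ M →
      ∃ λ E → Reachable G (M ⊛ X) E × M ℕ.* K ℕ.≤ E r
    covered-reach Kb≤ (divides c refl) =
      let E , p , le = concentrate 𝒲 c X in E , p , (begin
        c ℕ.* a r ℕ.* K             ≡⟨ ℕ.*-assoc c (a r) K ⟩
        c ℕ.* (a r ℕ.* K)           ≡⟨ cong (c ℕ.*_) (ℕ.*-comm (a r) K) ⟩
        c ℕ.* (K ℕ.* a r)           ≤⟨ ℕ.*-monoʳ-≤ c Kb≤ ⟩
        c ℕ.* weight a X            ≡⟨ sym (ℕ.*-identityʳ (c ℕ.* weight a X)) ⟩
        c ℕ.* weight a X ℕ.* 1      ≡⟨ cong (c ℕ.* weight a X ℕ.*_) (sym (δ-refl r)) ⟩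
        c ℕ.* weight a X ℕ.* δ r r  ≤⟨ le r ⟩
        E r                         ∎)
      where open ℕ.≤-Reasoning

  size-⊛ : ∀ M X → size G (M ⊛ X) ≡ M ℕ.* Σℕ.sum X
  size-⊛ M X = trans (size≡sum (M ⊛ X)) (sym (Σℕ.*-distribˡ-sum M X))

  -- The lower bound holds at every `t`, the matching upper bound only at multiples of `Q`;
  -- monotonicity in `t` fills the gaps at bounded cost.
  record LinearRate : Set where
    field
      q     : ℚ
      0≤q   : 0ℚ ≤ q
      Q     : ℕ
      1≤Q   : 1 ℕ.≤ Q
      lower : ∀ {t D} → Solvable G t D → q * ℕ→ℚ t ≤ ℕ→ℚ (size G D)
      upper : ∀ k → ∃ λ D → Solvable G (k ℕ.* Q) D × ℕ→ℚ (size G D) ≤ q * ℕ→ℚ (k ℕ.* Q)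

  linearRate : LinearRate
  linearRate = record
    -- The factor `K` clears the denominators of the optimal solution, and `P` is divisible by every
    -- `a r`, as gathering in full batches demands.
    { q = q ; 0≤q = 0≤q ; Q = P ℕ.* K ; 1≤Q = ℕ.*-mono-≤ 1≤P 1≤K
    ; lower = λ {t} {D} sol → subst (λ s → q * ℕ→ℚ t ≤ ℕ→ℚ s) (sym (size≡sum D))
        (minimal t D λ r → solvable-weight (slow (weighting r)) sol)
    ; upper = λ k → (k ℕ.* P) ⊛ X , solvable k , cheap k
    }
    where
    open Weighting
    -- One constraint per root, scaled by its own `a r`, so the powers of 2 need not agree between
    -- roots.
    open Covering (λ r → a (weighting r)) (λ r → a (weighting r) r)
    open Optimum (optimum λ r → term≤sum (a (weighting r)) r)
    common = commonMultiple (λ r → a (weighting r) r) (λ r → a-pos (weighting r))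
    P = proj₁ common
    1≤P = proj₁ (proj₂ common)
    solvable : ∀ k → Solvable G (k ℕ.* (P ℕ.* K)) ((k ℕ.* P) ⊛ X)
    solvable k r = subst (λ t → ∃ λ E → Reachable G ((k ℕ.* P) ⊛ X) E × t ℕ.≤ E r) (ℕ.*-assoc k P K)
      (covered-reach (weighting r) (covered r) (∣n⇒∣m*n k (proj₂ (proj₂ common) r)))
    cheap : ∀ k → ℕ→ℚ (size G ((k ℕ.* P) ⊛ X)) ≤ q * ℕ→ℚ (k ℕ.* (P ℕ.* K))
    cheap k = begin
      ℕ→ℚ (size G (M ⊛ X))       ≡⟨ cong ℕ→ℚ (size-⊛ M X) ⟩
      ℕ→ℚ (M ℕ.* Σℕ.sum X)       ≡⟨ ℕ→ℚ-* M (Σℕ.sum X) ⟩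
      m * ℕ→ℚ (Σℕ.sum X)         ≤⟨ *-monoˡ-≤-nonNeg m sum≤ ⟩
      m * (q * ℕ→ℚ K)            ≡⟨ solve 3 (λ m q k → m :* (q :* k) := q :* (m :* k)) refl m q (ℕ→ℚ K) ⟩
      q * (m * ℕ→ℚ K)            ≡⟨ cong (q *_) (sym (ℕ→ℚ-* M K)) ⟩
      q * ℕ→ℚ (M ℕ.* K)          ≡⟨ cong (λ t → q * ℕ→ℚ t) (ℕ.*-assoc k P K) ⟩
      q * ℕ→ℚ (k ℕ.* (P ℕ.* K))  ∎
      where
      open ≤-Reasoning
      M = k ℕ.* P
      m = ℕ→ℚ M
      instance
        m-nonNeg : NonNegative m
        m-nonNeg = nonNegative (0≤ℕ→ℚ M)

  -- Rounding up to multiples and the limit inferior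

  module _ (R : LinearRate) where
    open LinearRate R

    private instance
      Q-nonZero : ℕ.NonZero Q
      Q-nonZero = ℕ.>-nonZero 1≤Q

      q-nonNeg : NonNegative q
      q-nonNeg = nonNegative 0≤q

    optPebNum-lower : ∀ {t m} → IsOptPebNum G t m → q * ℕ→ℚ t ≤ ℕ→ℚ m
    optPebNum-lower ((D , sol , refl) , _) = lower sol

    -- At multiples of `Q` the two bounds meet, so the constructed distribution is optimal. This
    -- yields actual optimal values at arbitrarily large `t`, as the limit inferior requires.
    optPebNum-multiple : ∀ k → ∃ λ m →
      IsOptPebNum G (k ℕ.* Q) m × ℕ→ℚ m ≤ q * ℕ→ℚ (k ℕ.* Q)
    optPebNum-multiple k = let D , sol , cheap = upper k in
      size G D ,
      ((D , sol , refl) , λ E sol′ → ℕ→ℚ-cancel-≤ (≤-trans cheap (lower sol′))) ,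
      cheap

    solvable-mono : ∀ {s t D} → s ℕ.≤ t → Solvable G t D → Solvable G s D
    solvable-mono s≤t sol r = let E , p , t≤Er = sol r in E , p , ℕ.≤-trans s≤t t≤Er

    optPebNum-upper : ∀ {t m} → IsOptPebNum G t m → ℕ→ℚ m ≤ q * ℕ→ℚ Q + q * ℕ→ℚ t
    optPebNum-upper {t} {m} (_ , least) = begin
      ℕ→ℚ m                        ≤⟨ ℕ→ℚ-mono-≤ (least Dₖ (solvable-mono t≤kQ sol)) ⟩
      ℕ→ℚ (size G Dₖ)               ≤⟨ cheap ⟩
      q * ℕ→ℚ (k ℕ.* Q)            ≤⟨ *-monoˡ-≤-nonNeg q (ℕ→ℚ-mono-≤ kQ≤) ⟩
      q * ℕ→ℚ (Q ℕ.+ t)            ≡⟨ cong (q *_) (ℕ→ℚ-+ Q t) ⟩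
      q * (ℕ→ℚ Q + ℕ→ℚ t)          ≡⟨ *-distribˡ-+ q (ℕ→ℚ Q) (ℕ→ℚ t) ⟩
      q * ℕ→ℚ Q + q * ℕ→ℚ t        ∎
      where
      open ≤-Reasoning
      -- Always rounds up past `t`, by a full `Q` even when `Q` divides `t`; the additive constant
      -- absorbs this.
      k = suc (t / Q)
      Dₖ = proj₁ (upper k)
      sol = proj₁ (proj₂ (upper k))
      cheap = proj₂ (proj₂ (upper k))
      t≤kQ : t ℕ.≤ k ℕ.* Q
      t≤kQ = ℕ.≤-trans (ℕ.≤-reflexive (m≡m%n+[m/n]*n t Q)) (ℕ.+-monoˡ-≤ (t / Q ℕ.* Q) (m%n≤n t Q))
      kQ≤ : k ℕ.* Q ℕ.≤ Q ℕ.+ t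
      kQ≤ = ℕ.+-monoʳ-≤ Q (m/n*n≤m t Q)

    rate-isOptFracPebNum : IsOptFracPebNum G q
    rate-isOptFracPebNum = below , above
      where
      open ≤-Reasoning
      below : ∀ η → 0ℚ < η → ∃ λ T → ∀ t m → T ℕ.≤ t → 1 ℕ.≤ t → IsOptPebNum G t m →
        (q - η) * ℕ→ℚ t ≤ ℕ→ℚ m
      -- The threshold 0 works because the bound by `q` holds at every `t`, without error.
      below η 0<η = 0 , λ t m _ _ opt → begin
        (q - η) * ℕ→ℚ t  ≤⟨ *-monoʳ-≤-nonNeg (ℕ→ℚ t) {{nonNegative (0≤ℕ→ℚ t)}}
                              (+-monoʳ-≤ q (neg-antimono-≤ (<⇒≤ 0<η))) ⟩
        (q + 0ℚ) * ℕ→ℚ t ≡⟨ cong (_* ℕ→ℚ t) (+-identityʳ q) ⟩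
        q * ℕ→ℚ t        ≤⟨ optPebNum-lower opt ⟩
        ℕ→ℚ m            ∎
      above : ∀ η → 0ℚ < η → ∀ T → ∃ λ t → ∃ λ m → T ℕ.≤ t × 1 ℕ.≤ t × IsOptPebNum G t m ×
        ℕ→ℚ m ≤ (q + η) * ℕ→ℚ t
      above η 0<η T =
        -- Since `Q` is at least 1, the factor `suc T` makes `t` exceed `T` and hence also positive.
        let t = suc T ℕ.* Q
            m , opt , m≤ = optPebNum-multiple (suc T)
            T<t = ℕ.m≤m*n (suc T) Q
        in t , m , ℕ.≤-trans (ℕ.n≤1+n T) T<t , ℕ.≤-trans (s≤s z≤n) T<t , opt , (begin
          ℕ→ℚ m             ≤⟨ m≤ ⟩
          q * ℕ→ℚ t         ≡⟨ cong (_* ℕ→ℚ t) (sym (+-identityʳ q)) ⟩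
          (q + 0ℚ) * ℕ→ℚ t  ≤⟨ *-monoʳ-≤-nonNeg (ℕ→ℚ t) {{nonNegative (0≤ℕ→ℚ t)}}
                                 (+-monoʳ-≤ q (<⇒≤ 0<η)) ⟩
          (q + η) * ℕ→ℚ t   ∎)

    -- The deviation is one-sided: the lower bound makes the difference nonnegative, and rounding up
    -- to a multiple of `Q` costs at most `q * ℕ→ℚ Q`.
    optPebNum-deviation : ∀ t m → IsOptPebNum G t m → ∣ ℕ→ℚ m - q * ℕ→ℚ t ∣ ≤ q * ℕ→ℚ Q
    optPebNum-deviation t m opt = begin
      ∣ ℕ→ℚ m - q * ℕ→ℚ t ∣                    ≡⟨ 0≤p⇒∣p∣≡p (p≤q⇒0≤q-p (optPebNum-lower opt)) ⟩
      ℕ→ℚ m - q * ℕ→ℚ t                        ≤⟨ +-monoˡ-≤ (- (q * ℕ→ℚ t)) (optPebNum-upper opt) ⟩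
      q * ℕ→ℚ Q + q * ℕ→ℚ t - q * ℕ→ℚ t        ≡⟨ solve 2 (λ a b → a :+ b :- b := a) refl (q * ℕ→ℚ Q) (q * ℕ→ℚ t) ⟩
      q * ℕ→ℚ Q                                ∎
      where open ≤-Reasoning

theorem4p5 : (G : Graph) → ∃ λ (q : ℚ) → IsOptFracPebNum G q ×
    ∃ λ (C : ℚ) → ∀ (t m : ℕ) → IsOptPebNum G t m → ∣ ℕ→ℚ m - q * ℕ→ℚ t ∣ ≤ C
theorem4p5 G = q , rate-isOptFracPebNum linearRate , q * ℕ→ℚ Q , optPebNum-deviation linearRate
  where
  open Pebbling G
  open LinearRate linearRate
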